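{- Let $p=\sum_{i=0}^n c_iT^i$ be a polynomial of degree $n\ge1$ over $\mathbb S$ and let $a\in\{1,-1\}$ be a root of $p$. Define $l=\min\{i\in\mathbb N: c_i\ne0\}$ and $k=\min\{i\in\mathbb N: c_{i+1}=-a^{i+1-l}c_l\}$. Define $d_{n-1},\dots,d_0\in\mathbb S$ recursively in decreasing order of $i$ by: $d_i=c_{i+1}$ if $c_{i+1}\ne0$ and $i>k$; $d_i=ad_{i+1}$ if $c_{i+1}=0$ and $i>k$; $d_i=-a^{i+l-1}c_l$ if $l\le i\le k$; $d_i=0$ if $0\le i<l$. Then $q=\sum_{i=0}^{n-1}d_iT^i$ satisfies $p\in(T-a)\boxdot q$, i.e. $c_n=d_{n-1}$, $c_0=-ad_0$, and $c_i\in(-ad_i)\boxplus d_{i-1}$ for $i=1,\dots,n-1$.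
   Context: The sign hyperfield $\mathbb S$ is $\{0,1,-1\}$ with the usual multiplication and hyperaddition $0\boxplus a=\{a\}$, $1\boxplus1=\{1\}$, $(-1)\boxplus(-1)=\{ -1\}$, $1\boxplus(-1)=\{0,1,-1\}$. Iterated sums: $\boxplus_{i=1}^n a_i=\bigcup_{b\in\boxplus_{i=1}^{n-1}a_i} b\boxplus a_n$. Polynomials over $\mathbb S$ are finitely supported sequences $\sum c_iT^i$ of degree the largest $k$ with $c_k\ne0$; hyperproduct $p\boxdot q=\{\sum e_iT^i : e_i\in \boxplus_{k+l=i} c_kd_l\}$. An element $a\in\mathbb S$ is a root of $p=\sum c_iT^i$ if $0\in\boxplus_i c_ia^i$. -}

module Defs where

open import Data.Integer using (ℤ; +_; -[1+_]; _⊖_)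
open import Data.Nat using (ℕ; zero; suc; _+_; _∸_; _≤_; _<_; s≤s; _≤?_; _<?_)
open import Data.Nat.Properties using (m≤n⇒m∸n≡0)
open import Data.Product using (_×_; ∃-syntax)
open import Level using (0ℓ)
open import Relation.Binary.Definitions using (DecidableEquality)
open import Relation.Binary.PropositionalEquality using (_≡_; _≢_; refl)
open import Relation.Nullary using (yes; no)
open import Relation.Unary using (Pred; _∈_; ｛_｝; U)

infix  8 -ₛ_
infixr 9 _^_ _^ᶻ_
infixl 7 _·_ _⊡_
infixl 6 _⊞_

data 𝕊 : Set where
  0ₛ 1ₛ -1ₛ : 𝕊

_≟_ : DecidableEquality 𝕊
0ₛ  ≟ 0ₛ  = yes refl
0ₛ  ≟ 1ₛ  = no λ ()
0ₛ  ≟ -1ₛ = no λ ()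
1ₛ  ≟ 0ₛ  = no λ ()
1ₛ  ≟ 1ₛ  = yes refl
1ₛ  ≟ -1ₛ = no λ ()
-1ₛ ≟ 0ₛ  = no λ ()
-1ₛ ≟ 1ₛ  = no λ ()
-1ₛ ≟ -1ₛ = yes refl

-ₛ_ : 𝕊 → 𝕊
-ₛ 0ₛ  = 0ₛ
-ₛ 1ₛ  = -1ₛ
-ₛ -1ₛ = 1ₛ

_·_ : 𝕊 → 𝕊 → 𝕊
0ₛ  · b = 0ₛ
1ₛ  · b = b
-1ₛ · b = -ₛ b

-- On the units 1 and -1 this is the multiplicative inverse; the value at 0 is
-- a junk value.
_⁻¹ : 𝕊 → 𝕊
0ₛ  ⁻¹ = 0ₛ
1ₛ  ⁻¹ = 1ₛ
-1ₛ ⁻¹ = -1ₛ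

_^_ : 𝕊 → ℕ → 𝕊
a ^ zero  = 1ₛ
a ^ suc n = a · a ^ n

_^ᶻ_ : 𝕊 → ℤ → 𝕊
a ^ᶻ (+ n)    = a ^ n
a ^ᶻ -[1+ n ] = (a ⁻¹) ^ suc n

_⊞_ : 𝕊 → 𝕊 → Pred 𝕊 0ℓ
0ₛ  ⊞ b   = ｛ b ｝
1ₛ  ⊞ 0ₛ  = ｛ 1ₛ ｝
1ₛ  ⊞ 1ₛ  = ｛ 1ₛ ｝
1ₛ  ⊞ -1ₛ = U
-1ₛ ⊞ 0ₛ  = ｛ -1ₛ ｝
-1ₛ ⊞ 1ₛ  = U
-1ₛ ⊞ -1ₛ = ｛ -1ₛ ｝

-- Sum over the n indices i < n.  The empty sum is {0}, so the one-term sum is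
-- 0 ⊞ f 0 = {f 0}.
⨁ : ℕ → (ℕ → 𝕊) → Pred 𝕊 0ℓ
⨁ zero    f = ｛ 0ₛ ｝
⨁ (suc n) f = λ x → ∃[ b ] b ∈ ⨁ n f × x ∈ b ⊞ f n

record Poly : Set where
  field
    coeff    : ℕ → 𝕊
    bound    : ℕ
    vanishes : ∀ i → bound ≤ i → coeff i ≡ 0ₛ

open Poly public

HasDegree : Poly → ℕ → Set
HasDegree p n = coeff p n ≢ 0ₛ × (∀ i → n < i → coeff p i ≡ 0ₛ)

-- The choice of bound is immaterial: x ⊞ 0 = {x}, so trailing zero terms do not
-- change the sum.
IsRoot : Poly → 𝕊 → Set
IsRoot p a = 0ₛ ∈ ⨁ (bound p) (λ i → coeff p i · a ^ i)

-- The pairs (j , j′) with j + j′ = i are enumerated as (j , i ∸ j) for j ≤ i.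
_⊡_ : Poly → Poly → Pred Poly 0ℓ
(p ⊡ q) e = ∀ i → coeff e i ∈ ⨁ (suc i) (λ j → coeff p j · coeff q (i ∸ j))

T-_ : 𝕊 → Poly
T- a = record { coeff = c ; bound = 2 ; vanishes = v }
  where
  c : ℕ → 𝕊
  c 0             = -ₛ a
  c 1             = 1ₛ
  c (suc (suc _)) = 0ₛ

  v : ∀ i → 2 ≤ i → c i ≡ 0ₛ
  v (suc zero)    (s≤s ())
  v (suc (suc _)) _ = refl

IsMin : Pred ℕ 0ℓ → Pred ℕ 0ℓ
IsMin P m = m ∈ P × (∀ i → i ∈ P → m ≤ i)

IsL : Poly → ℕ → Set
IsL p = IsMin (λ i → coeff p i ≢ 0ₛ)

-- The exponent i + 1 - l is an integer and may be negative.
IsK : Poly → 𝕊 → ℕ → ℕ → Set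
IsK p a l = IsMin (λ i → coeff p (suc i) ≡ -ₛ (a ^ᶻ (suc i ⊖ l) · coeff p l))

module Quotient (p : Poly) (n : ℕ) (a : 𝕊) (l k : ℕ) where

  -- The descending recursion for d_i runs on m = n - i, so that d_{i+1} is
  -- dRec (m - 1) (i + 1); the value at m = 0 extends d by zero to i ≥ n.
  -- The exponent i + l - 1 is -1 when i = l = 0.
  dRec : ℕ → ℕ → 𝕊
  dRec zero    i = 0ₛ
  dRec (suc m) i with k <? i | coeff p (suc i) ≟ 0ₛ | l ≤? i
  ... | yes _ | no _  | _     = coeff p (suc i)
  ... | yes _ | yes _ | _     = a · dRec m (suc i)
  ... | no _  | _     | yes _ = -ₛ (a ^ᶻ ((i + l) ⊖ 1) · coeff p l)
  ... | no _  | _     | no _  = 0ₛ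

  d : ℕ → 𝕊
  d i = dRec (n ∸ i) i

  q : Poly
  q = record { coeff = d ; bound = n ; vanishes = v }
    where
    v : ∀ i → n ≤ i → d i ≡ 0ₛ
    v i n≤i rewrite m≤n⇒m∸n≡0 n≤i = refl

{-# OPTIONS --safe #-}

-- If t is the lowest nonzero term of the root condition at a, a hypersum of
-- terms t and 0 containing t is {t}, so 0 can only occur when some later term
-- is -t; this gives k.  With s i = a^(i+l) c_l (reflected l i) one has s l = c_l,
-- c_{k+1} = - s (k+1), and d_i = - s (i+1) for l ≤ i ≤ k, so -a d_i = s i.
-- Hence c_i ∈ (-a d_i) ⊞ d_{i-1} reads c_i ∈ s i ⊞ (- s i) = 𝕊 for l < i ≤ k,
-- while for i > k either d_{i-1} = c_i ≠ 0 or c_i = 0 and d_{i-1} = a d_i.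
module Submission where

open import Data.Integer using (_⊖_)
open import Data.Integer.Properties using ([1+m]⊖[1+n]≡m⊖n; n⊖n≡0)
open import Data.Nat using (ℕ; zero; suc; _+_; _∸_; _≤_; _<_; z≤n; s≤s; _≤?_; _<?_)
open import Data.Nat.Properties
  using (+-comm; +-suc; +-identityʳ; +-∸-assoc; ≤-refl; ≤-trans; ≤-<-trans; <-trans; ≤-pred;
         <⇒≤; <⇒≱; ≰⇒>; ≮⇒≥; ≤∧≢⇒<; m≤n⇒m≤1+n; m≤n⇒m<n∨m≡n)
open import Data.Product using (_×_; ∃-syntax; _,_; proj₁; proj₂)
open import Data.Sum using (_⊎_; inj₁; inj₂)
open import Data.Unit using (tt)
open import Function using (_∘_)
open import Level using (0ℓ)
open import Relation.Binary.PropositionalEquality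
  using (_≡_; _≢_; refl; sym; trans; cong; subst; module ≡-Reasoning)
open import Relation.Nullary using (yes; no; ¬?; contradiction)
open import Relation.Unary using (Pred; Decidable; _∈_)
open import Defs

-- Arithmetic of signs

IsUnit : 𝕊 → Set
IsUnit a = a ≡ 1ₛ ⊎ a ≡ -1ₛ

neg-involutive : ∀ x → -ₛ (-ₛ x) ≡ x
neg-involutive 0ₛ  = refl
neg-involutive 1ₛ  = refl
neg-involutive -1ₛ = refl

neg-≢0 : ∀ {x} → x ≢ 0ₛ → -ₛ x ≢ 0ₛ
neg-≢0 {0ₛ} x≢0 = λ _ → x≢0 refl
neg-≢0 {1ₛ} _ ()
neg-≢0 { -1ₛ} _ ()

≢0⇒≢neg : ∀ {x} → x ≢ 0ₛ → x ≢ -ₛ x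
≢0⇒≢neg {0ₛ} x≢0 _ = x≢0 refl
≢0⇒≢neg {1ₛ} _ ()
≢0⇒≢neg { -1ₛ} _ ()

·-zeroʳ : ∀ a → a · 0ₛ ≡ 0ₛ
·-zeroʳ 0ₛ  = refl
·-zeroʳ 1ₛ  = refl
·-zeroʳ -1ₛ = refl

·-identityʳ : ∀ a → a · 1ₛ ≡ a
·-identityʳ 0ₛ  = refl
·-identityʳ 1ₛ  = refl
·-identityʳ -1ₛ = refl

neg-distribˡ-· : ∀ a b → (-ₛ a) · b ≡ -ₛ (a · b)
neg-distribˡ-· 0ₛ  b = refl
neg-distribˡ-· 1ₛ  b = refl
neg-distribˡ-· -1ₛ b = sym (neg-involutive b)

neg-distribʳ-· : ∀ a b → a · (-ₛ b) ≡ -ₛ (a · b)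
neg-distribʳ-· 0ₛ  b = refl
neg-distribʳ-· 1ₛ  b = refl
neg-distribʳ-· -1ₛ b = refl

·-assoc : ∀ a b c → (a · b) · c ≡ a · (b · c)
·-assoc 0ₛ  b c = refl
·-assoc 1ₛ  b c = refl
·-assoc -1ₛ b c = neg-distribˡ-· b c

·-comm : ∀ a b → a · b ≡ b · a
·-comm 0ₛ  b = sym (·-zeroʳ b)
·-comm 1ₛ  b = sym (·-identityʳ b)
·-comm -1ₛ b = sym (trans (neg-distribʳ-· b 1ₛ) (cong -ₛ_ (·-identityʳ b)))

unit-· : ∀ {a b} → IsUnit a → IsUnit b → IsUnit (a · b)
unit-· (inj₁ refl) u           = u
unit-· (inj₂ refl) (inj₁ refl) = inj₂ refl
unit-· (inj₂ refl) (inj₂ refl) = inj₁ refl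

unit-^ : ∀ {a} → IsUnit a → ∀ n → IsUnit (a ^ n)
unit-^ u zero    = inj₁ refl
unit-^ u (suc n) = unit-· u (unit-^ u n)

unit-⁻¹ : ∀ {a} → IsUnit a → a ⁻¹ ≡ a
unit-⁻¹ (inj₁ refl) = refl
unit-⁻¹ (inj₂ refl) = refl

unit-·-involutive : ∀ {a} → IsUnit a → ∀ x → a · (a · x) ≡ x
unit-·-involutive (inj₁ refl) x = refl
unit-·-involutive (inj₂ refl) x = neg-involutive x

unit-·-≢0 : ∀ {a x} → IsUnit a → x ≢ 0ₛ → a · x ≢ 0ₛ
unit-·-≢0 (inj₁ refl) x≢0 = x≢0
unit-·-≢0 (inj₂ refl) x≢0 = neg-≢0 x≢0

^-distribˡ-+-· : ∀ a m n → a ^ (m + n) ≡ a ^ m · a ^ n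
^-distribˡ-+-· a zero    n = refl
^-distribˡ-+-· a (suc m) n =
  trans (cong (a ·_) (^-distribˡ-+-· a m n)) (sym (·-assoc a (a ^ m) (a ^ n)))

-- A unit is its own inverse, so subtracting exponents amounts to adding them.
^ᶻ-⊖ : ∀ {a} → IsUnit a → ∀ m n → a ^ᶻ (m ⊖ n) ≡ a ^ (m + n)
^ᶻ-⊖ {a} u zero    zero    = refl
^ᶻ-⊖ {a} u zero    (suc n) = cong (_^ suc n) (unit-⁻¹ u)
^ᶻ-⊖ {a} u (suc m) zero    = cong (a ^_) (sym (+-identityʳ (suc m)))
^ᶻ-⊖ {a} u (suc m) (suc n) = begin
  a ^ᶻ (suc m ⊖ suc n)    ≡⟨ cong (a ^ᶻ_) ([1+m]⊖[1+n]≡m⊖n m n) ⟩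
  a ^ᶻ (m ⊖ n)            ≡⟨ ^ᶻ-⊖ u m n ⟩
  a ^ (m + n)             ≡⟨ unit-·-involutive u _ ⟨
  a · (a · a ^ (m + n))   ≡⟨ cong (λ e → a · a ^ e) (+-suc m n) ⟨
  a ^ (suc m + suc n)     ∎
  where open ≡-Reasoning

-- Hyperaddition

∈-⊞-0 : ∀ x → x ∈ x ⊞ 0ₛ
∈-⊞-0 0ₛ  = refl
∈-⊞-0 1ₛ  = refl
∈-⊞-0 -1ₛ = refl

∈-⊞-≢0 : ∀ x {y} → y ≢ 0ₛ → y ∈ x ⊞ y
∈-⊞-≢0 0ₛ  _ = refl
∈-⊞-≢0 1ₛ  {0ₛ} y≢0 = contradiction refl y≢0
∈-⊞-≢0 1ₛ  {1ₛ} _ = refl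
∈-⊞-≢0 1ₛ  { -1ₛ} _ = tt
∈-⊞-≢0 -1ₛ {0ₛ} y≢0 = contradiction refl y≢0
∈-⊞-≢0 -1ₛ {1ₛ} _ = tt
∈-⊞-≢0 -1ₛ { -1ₛ} _ = refl

0∈-neg-⊞ : ∀ x → 0ₛ ∈ (-ₛ x) ⊞ x
0∈-neg-⊞ 0ₛ  = refl
0∈-neg-⊞ 1ₛ  = tt
0∈-neg-⊞ -1ₛ = tt

∈-⊞-neg : ∀ x {y} → y ≢ 0ₛ → x ∈ y ⊞ (-ₛ y)
∈-⊞-neg x {0ₛ} y≢0 = contradiction refl y≢0
∈-⊞-neg x {1ₛ} _ = tt
∈-⊞-neg x { -1ₛ} _ = tt

-- Hyperaddition creates no new nonzero value: 1 ⊞ -1 is all of `𝕊`, but its nonzero elements are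
-- the two summands.
∈-⊞-≢0⁻ : ∀ {x} b y → x ≢ 0ₛ → x ∈ b ⊞ y → b ≡ x ⊎ y ≡ x
∈-⊞-≢0⁻ 0ₛ  y   _ e = inj₂ e
∈-⊞-≢0⁻ 1ₛ  0ₛ  _ e = inj₁ e
∈-⊞-≢0⁻ 1ₛ  1ₛ  _ e = inj₁ e
∈-⊞-≢0⁻ { 0ₛ} 1ₛ  -1ₛ x≢0 _ = contradiction refl x≢0
∈-⊞-≢0⁻ { 1ₛ} 1ₛ  -1ₛ _ _ = inj₁ refl
∈-⊞-≢0⁻ { -1ₛ} 1ₛ  -1ₛ _ _ = inj₂ refl
∈-⊞-≢0⁻ -1ₛ 0ₛ  _ e = inj₁ e
∈-⊞-≢0⁻ { 0ₛ} -1ₛ 1ₛ x≢0 _ = contradiction refl x≢0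
∈-⊞-≢0⁻ { 1ₛ} -1ₛ 1ₛ _ _ = inj₂ refl
∈-⊞-≢0⁻ { -1ₛ} -1ₛ 1ₛ _ _ = inj₁ refl
∈-⊞-≢0⁻ -1ₛ -1ₛ _ e = inj₁ e

-- A nonzero `t` absorbs 0 and itself; only `-ₛ t` makes the sum multivalued.
∈-⊞-sameˡ : ∀ {x t y} → t ≢ 0ₛ → y ≢ -ₛ t → x ∈ t ⊞ y → x ≡ t
∈-⊞-sameˡ {t = 0ₛ}            t≢0 _    _ = contradiction refl t≢0
∈-⊞-sameˡ {t = 1ₛ}  {y = 0ₛ}  _   _    e = sym e
∈-⊞-sameˡ {t = 1ₛ}  {y = 1ₛ}  _   _    e = sym e
∈-⊞-sameˡ {t = 1ₛ}  {y = -1ₛ} _   y≢-t _ = contradiction refl y≢-t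
∈-⊞-sameˡ {t = -1ₛ} {y = 0ₛ}  _   _    e = sym e
∈-⊞-sameˡ {t = -1ₛ} {y = 1ₛ}  _   y≢-t _ = contradiction refl y≢-t
∈-⊞-sameˡ {t = -1ₛ} {y = -1ₛ} _   _    e = sym e

∈-⊞-sameʳ : ∀ {x b t} → t ≢ 0ₛ → b ≢ -ₛ t → x ∈ b ⊞ t → x ≡ t
∈-⊞-sameʳ {b = 0ₛ}            _   _    e = sym e
∈-⊞-sameʳ {b = 1ₛ}  {t = 0ₛ}  t≢0 _    _ = contradiction refl t≢0
∈-⊞-sameʳ {b = 1ₛ}  {t = 1ₛ}  _   _    e = sym e
∈-⊞-sameʳ {b = 1ₛ}  {t = -1ₛ} _   b≢-t _ = contradiction refl b≢-t
∈-⊞-sameʳ {b = -1ₛ} {t = 0ₛ}  t≢0 _    _ = contradiction refl t≢0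
∈-⊞-sameʳ {b = -1ₛ} {t = 1ₛ}  _   b≢-t _ = contradiction refl b≢-t
∈-⊞-sameʳ {b = -1ₛ} {t = -1ₛ} _   _    e = sym e

-- Iterated hypersums, least witnesses, products with `T- a`

∈-⨁⇒∃ : ∀ {x} f n → x ≢ 0ₛ → x ∈ ⨁ n f → ∃[ i ] f i ≡ x
∈-⨁⇒∃ f zero    x≢0 e = contradiction (sym e) x≢0
∈-⨁⇒∃ f (suc n) x≢0 (b , b∈ , x∈) with ∈-⊞-≢0⁻ b (f n) x≢0 x∈
... | inj₁ refl = ∈-⨁⇒∃ f n x≢0 b∈
... | inj₂ fn≡x = n , fn≡x

-- Peel off the last term, with t = `f l` and partial sum `b`. If `b` is -t, then -t occurs among
-- the earlier terms. If neither `b` nor the last term is -t, a last term t would force x = t;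
-- otherwise `b` = t would, so `b` differs from t and the induction continues. This is why `x` is
-- general and not just 0.
∃-opposite : ∀ {x} f n {l} → f l ≢ 0ₛ → l < n → x ∈ ⨁ n f → x ≢ f l →
             ∃[ i ] f i ≡ -ₛ (f l)
∃-opposite f (suc n) {l} t≢0 l<1+n (b , b∈ , x∈) x≢t
  with f n ≟ (-ₛ f l) | b ≟ (-ₛ f l) | m≤n⇒m<n∨m≡n (≤-pred l<1+n)
... | yes fn≡-t | _          | _        = n , fn≡-t
... | no _      | yes refl   | _        = ∈-⨁⇒∃ f n (neg-≢0 t≢0) b∈
... | no _      | no b≢-t    | inj₂ refl = contradiction (∈-⊞-sameʳ t≢0 b≢-t x∈) x≢t
... | no fn≢-t  | no _       | inj₁ l<n =
  ∃-opposite f n t≢0 l<n b∈ λ { refl → x≢t (∈-⊞-sameˡ t≢0 fn≢-t x∈) }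

⨁-trailing-0 : ∀ {x} f m n → x ∈ ⨁ m f → (∀ i → f (i + m) ≡ 0ₛ) → x ∈ ⨁ (n + m) f
⨁-trailing-0 f m zero    x∈ _  = x∈
⨁-trailing-0 {x} f m (suc n) x∈ f≡0 =
  x , ⨁-trailing-0 f m n x∈ f≡0 , subst (λ y → x ∈ x ⊞ y) (sym (f≡0 n)) (∈-⊞-0 x)

least : ∀ {P : Pred ℕ 0ℓ} → Decidable P → ∀ m → m ∈ P → ∃[ k ] IsMin P k
least P? zero    pm = zero , pm , λ _ _ → z≤n
least P? (suc m) pm with P? 0
... | yes p0 = zero , p0 , λ _ _ → z≤n
... | no ¬p0 with least (P? ∘ suc) m pm
...   | k , pk , k-min = suc k , pk , λ
  { zero    p0 → contradiction p0 ¬p0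
  ; (suc i) pi → s≤s (k-min i pi)
  }

T-∈-⊡ : ∀ e a q → coeff e 0 ≡ -ₛ (a · coeff q 0) →
        (∀ i → coeff e (suc i) ∈ (-ₛ (a · coeff q (suc i))) ⊞ coeff q i) →
        e ∈ (T- a) ⊡ q
T-∈-⊡ e a q e₀ _  zero    = 0ₛ , refl , trans (neg-distribˡ-· a (coeff q 0)) (sym e₀)
T-∈-⊡ e a q _  e₊ (suc i) =
  -- The sum has i + 2 terms: the two from the coefficients -a and 1 of `T- a`, then i zeros.
  subst (λ n → coeff e (suc i) ∈ ⨁ n f) (+-comm i 2) (⨁-trailing-0 f 2 i two-terms tail≡0)
  where
  f : ℕ → 𝕊
  f j = coeff (T- a) j · coeff q (suc i ∸ j)

  two-terms : coeff e (suc i) ∈ ⨁ 2 f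
  two-terms = _ , (0ₛ , refl , neg-distribˡ-· a (coeff q (suc i))) , e₊ i

  tail≡0 : ∀ j → f (j + 2) ≡ 0ₛ
  tail≡0 j = cong (λ m → coeff (T- a) m · coeff q (suc i ∸ m)) (+-comm j 2)

-- Existence of `l` and `k`

module _ (p : Poly) {a : 𝕊} (u : IsUnit a) where

  -- The coefficient whose term at position `i`, evaluated at `a`, equals the lowest term
  -- `coeff p l · a ^ l`. As `a` is its own inverse, i + l stands in for the integer exponent i - l.
  reflected : ℕ → ℕ → 𝕊
  reflected l i = a ^ (i + l) · coeff p l

  reflected-self : ∀ l → reflected l l ≡ coeff p l
  reflected-self l = cong (_· coeff p l) (begin
    a ^ (l + l)    ≡⟨ ^ᶻ-⊖ u l l ⟨
    a ^ᶻ (l ⊖ l)   ≡⟨ cong (a ^ᶻ_) (n⊖n≡0 l) ⟩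
    1ₛ             ∎)
    where open ≡-Reasoning

  reflected-suc : ∀ l i → reflected l (suc i) ≡ a · reflected l i
  reflected-suc l i = ·-assoc a (a ^ (i + l)) (coeff p l)

  neg-·-neg-reflected : ∀ l i → -ₛ (a · -ₛ (reflected l (suc i))) ≡ reflected l i
  neg-·-neg-reflected l i = begin
    -ₛ (a · -ₛ (reflected l (suc i)))   ≡⟨ cong -ₛ_ (neg-distribʳ-· a _) ⟩
    -ₛ (-ₛ (a · reflected l (suc i)))   ≡⟨ neg-involutive _ ⟩
    a · reflected l (suc i)             ≡⟨ cong (a ·_) (reflected-suc l i) ⟩
    a · (a · reflected l i)             ≡⟨ unit-·-involutive u _ ⟩
    reflected l i                       ∎
    where open ≡-Reasoning

  -- Multiplying by `a ^ i`, whose square is 1, passes from terms of the root sum to coefficients.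
  opposite-terms : ∀ {l i} → coeff p i · a ^ i ≡ -ₛ (coeff p l · a ^ l) →
                   coeff p i ≡ -ₛ (reflected l i)
  opposite-terms {l} {i} e = begin
    coeff p i                               ≡⟨ unit-·-involutive (unit-^ u i) _ ⟨
    a ^ i · (a ^ i · coeff p i)             ≡⟨ cong (a ^ i ·_) (·-comm (a ^ i) _) ⟩
    a ^ i · (coeff p i · a ^ i)             ≡⟨ cong (a ^ i ·_) e ⟩
    a ^ i · -ₛ (coeff p l · a ^ l)          ≡⟨ neg-distribʳ-· (a ^ i) _ ⟩
    -ₛ (a ^ i · (coeff p l · a ^ l))        ≡⟨ cong (λ x → -ₛ (a ^ i · x)) (·-comm (coeff p l) _) ⟩
    -ₛ (a ^ i · (a ^ l · coeff p l))        ≡⟨ cong -ₛ_ (·-assoc (a ^ i) (a ^ l) _) ⟨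
    -ₛ (a ^ i · a ^ l · coeff p l)          ≡⟨ cong (λ x → -ₛ (x · coeff p l)) (^-distribˡ-+-· a i l) ⟨
    -ₛ (reflected l i)                      ∎
    where open ≡-Reasoning

  ∃-isL : ∀ {n} → HasDegree p n → ∃[ l ] IsL p l
  ∃-isL {n} (cₙ≢0 , _) = least (λ i → ¬? (coeff p i ≟ 0ₛ)) n cₙ≢0

  module _ {l : ℕ} (isL : IsL p l) where

    cₗ≢0 : coeff p l ≢ 0ₛ
    cₗ≢0 = proj₁ isL

    coeff-below : ∀ {i} → i < l → coeff p i ≡ 0ₛ
    coeff-below {i} i<l with coeff p i ≟ 0ₛ
    ... | yes cᵢ≡0 = cᵢ≡0
    ... | no cᵢ≢0  = contradiction (proj₂ isL i cᵢ≢0) (<⇒≱ i<l)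

    reflected-≢0 : ∀ i → reflected l i ≢ 0ₛ
    reflected-≢0 i = unit-·-≢0 (unit-^ u (i + l)) cₗ≢0

    opposite-≢0 : ∀ {i} → coeff p i ≡ -ₛ (reflected l i) → coeff p i ≢ 0ₛ
    opposite-≢0 {i} e = neg-≢0 (reflected-≢0 i) ∘ trans (sym e)

    -- Such a coefficient is nonzero, so minimality gives l ≤ i; at i = l it would equal its own
    -- negative.
    opposite-above : ∀ {i} → coeff p i ≡ -ₛ (reflected l i) → l < i
    opposite-above {i} e with m≤n⇒m<n∨m≡n (proj₂ isL i (opposite-≢0 e))
    ... | inj₁ l<i  = l<i
    ... | inj₂ refl = contradiction (trans e (cong -ₛ_ (reflected-self l))) (≢0⇒≢neg cₗ≢0)

    lowest-term-≢0 : coeff p l · a ^ l ≢ 0ₛ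
    lowest-term-≢0 = unit-·-≢0 (unit-^ u l) cₗ≢0 ∘ trans (·-comm (a ^ l) (coeff p l))

    ∃-isK : IsRoot p a → ∃[ k ] IsK p a l k
    ∃-isK root
      with i , e ← ∃-opposite (λ i → coeff p i · a ^ i) (bound p) lowest-term-≢0
                     -- A nonzero coefficient lies below the bound, so the lowest term does occur in
                     -- the root sum.
                     (≰⇒> (cₗ≢0 ∘ vanishes p l)) root (lowest-term-≢0 ∘ sym)
      with i | opposite-terms {l} {i} e
    -- `IsK` records the predecessor of the position of the opposite term, which is positive because
    -- it exceeds `l`.
    ... | zero  | e′ = contradiction (opposite-above e′) λ ()
    ... | suc j | e′ = least (λ i → coeff p (suc i) ≟ _) j
      (trans e′ (cong (λ x → -ₛ (x · coeff p l)) (sym (^ᶻ-⊖ u (suc j) l))))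

    -- Coefficients of the quotient

    module _ {n k : ℕ} (deg : HasDegree p n) (isK : IsK p a l k) where

      open Quotient p n a l k

      coeff-suc-k : coeff p (suc k) ≡ -ₛ (reflected l (suc k))
      coeff-suc-k = trans (proj₁ isK) (cong (λ x → -ₛ (x · coeff p l)) (^ᶻ-⊖ u (suc k) l))

      l≤k : l ≤ k
      l≤k = ≤-pred (opposite-above coeff-suc-k)

      ≢0⇒≤n : ∀ {i} → coeff p i ≢ 0ₛ → i ≤ n
      ≢0⇒≤n {i} cᵢ≢0 = ≮⇒≥ (cᵢ≢0 ∘ proj₂ deg i)

      k<n : k < n
      k<n = ≢0⇒≤n (opposite-≢0 coeff-suc-k)

      -- `dRec` is stuck on `n ∸ i`; exposing a successor lets its second clause apply.
      d-unfold : ∀ {i} → i < n → d i ≡ dRec (suc (n ∸ suc i)) i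
      d-unfold {i} i<n = cong (λ m → dRec m i) (+-∸-assoc 1 i<n)

      -- Repeating the three scrutinees of `dRec` makes it reduce; the next three lemmas treat the
      -- other branches alike.
      dRec-nonzero : ∀ m {i} → k < i → coeff p (suc i) ≢ 0ₛ → dRec (suc m) i ≡ coeff p (suc i)
      dRec-nonzero m {i} k<i c≢0 with k <? i | coeff p (suc i) ≟ 0ₛ | l ≤? i
      ... | yes _   | no _    | _ = refl
      ... | yes _   | yes c≡0 | _ = contradiction c≡0 c≢0
      ... | no k≮i  | _       | _ = contradiction k<i k≮i

      dRec-zero : ∀ m {i} → k < i → coeff p (suc i) ≡ 0ₛ → dRec (suc m) i ≡ a · dRec m (suc i)
      dRec-zero m {i} k<i c≡0 with k <? i | coeff p (suc i) ≟ 0ₛ | l ≤? i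
      ... | yes _   | no c≢0  | _ = contradiction c≡0 c≢0
      ... | yes _   | yes _   | _ = refl
      ... | no k≮i  | _       | _ = contradiction k<i k≮i

      dRec-middle : ∀ m {i} → l ≤ i → i ≤ k →
                    dRec (suc m) i ≡ -ₛ (a ^ᶻ ((i + l) ⊖ 1) · coeff p l)
      dRec-middle m {i} l≤i i≤k with k <? i | coeff p (suc i) ≟ 0ₛ | l ≤? i
      ... | yes k<i | _ | _       = contradiction i≤k (<⇒≱ k<i)
      ... | no _    | _ | yes _   = refl
      ... | no _    | _ | no l≰i  = contradiction l≤i l≰i

      dRec-low : ∀ m {i} → i < l → dRec (suc m) i ≡ 0ₛ
      dRec-low m {i} i<l with k <? i | coeff p (suc i) ≟ 0ₛ | l ≤? i
      ... | yes k<i | _ | _       = contradiction (≤-trans (<⇒≤ i<l) l≤k) (<⇒≱ k<i)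
      ... | no _    | _ | yes l≤i = contradiction l≤i (<⇒≱ i<l)
      ... | no _    | _ | no _    = refl

      -- The exponents i + l - 1 and i + l + 1 have the same parity, which also covers the exponent
      -- -1 at i = l = 0.
      d-middle : ∀ {i} → l ≤ i → i ≤ k → d i ≡ -ₛ (reflected l (suc i))
      d-middle {i} l≤i i≤k = begin
        d i                                     ≡⟨ d-unfold (≤-<-trans i≤k k<n) ⟩
        dRec (suc (n ∸ suc i)) i                ≡⟨ dRec-middle _ l≤i i≤k ⟩
        -ₛ (a ^ᶻ ((i + l) ⊖ 1) · coeff p l)     ≡⟨ cong (λ x → -ₛ (x · coeff p l)) (^ᶻ-⊖ u (i + l) 1) ⟩
        -ₛ (a ^ (i + l + 1) · coeff p l)        ≡⟨ cong (λ e → -ₛ (a ^ e · coeff p l)) (+-comm (i + l) 1) ⟩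
        -ₛ (reflected l (suc i))                ∎
        where open ≡-Reasoning

      d-low : ∀ {i} → i < l → d i ≡ 0ₛ
      d-low i<l = trans (d-unfold (<-trans i<l (≤-<-trans l≤k k<n))) (dRec-low _ i<l)

      -- The defining clause starts above `k`; at i = k the middle clause yields the same value, by
      -- the choice of `k`.
      d-nonzero : ∀ {i} → k ≤ i → coeff p (suc i) ≢ 0ₛ → d i ≡ coeff p (suc i)
      d-nonzero k≤i c≢0 with m≤n⇒m<n∨m≡n k≤i
      ... | inj₁ k<i  = trans (d-unfold (≢0⇒≤n c≢0)) (dRec-nonzero _ k<i c≢0)
      ... | inj₂ refl = trans (d-middle l≤k ≤-refl) (sym coeff-suc-k)

      d-zero : ∀ {i} → k < i → coeff p (suc i) ≡ 0ₛ → d i ≡ a · d (suc i)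
      d-zero {i} k<i c≡0 with i <? n
      ... | yes i<n = trans (d-unfold i<n) (dRec-zero _ k<i c≡0)
      -- From `n` on `d` is 0, so the recursion persists and handles the coefficients beyond the
      -- degree.
      ... | no i≮n  = begin
        d i             ≡⟨ vanishes q i n≤i ⟩
        0ₛ              ≡⟨ ·-zeroʳ a ⟨
        a · 0ₛ          ≡⟨ cong (a ·_) (vanishes q (suc i) (m≤n⇒m≤1+n n≤i)) ⟨
        a · d (suc i)   ∎
        where
        open ≡-Reasoning
        n≤i = ≮⇒≥ i≮n

      neg-·-d : ∀ {i} → l ≤ i → i ≤ k → -ₛ (a · d i) ≡ reflected l i
      neg-·-d {i} l≤i i≤k =
        trans (cong (λ x → -ₛ (a · x)) (d-middle l≤i i≤k)) (neg-·-neg-reflected l i)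

      -- Both sides are 0 below `l`, and at `l` both are `reflected l l`. The instance i = 0 is the
      -- constant term of the product.
      coeff-up-to-l : ∀ {i} → i ≤ l → coeff p i ≡ -ₛ (a · d i)
      coeff-up-to-l {i} i≤l with m≤n⇒m<n∨m≡n i≤l
      ... | inj₁ i<l  = begin
        coeff p i       ≡⟨ coeff-below i<l ⟩
        -ₛ 0ₛ           ≡⟨ cong -ₛ_ (·-zeroʳ a) ⟨
        -ₛ (a · 0ₛ)     ≡⟨ cong (λ x → -ₛ (a · x)) (d-low i<l) ⟨
        -ₛ (a · d i)    ∎
        where open ≡-Reasoning
      ... | inj₂ refl = trans (sym (reflected-self l)) (sym (neg-·-d ≤-refl l≤k))

      coeff-∈ : ∀ i → coeff p (suc i) ∈ (-ₛ (a · d (suc i))) ⊞ d i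
      coeff-∈ i with k ≤? i | coeff p (suc i) ≟ 0ₛ | l ≤? i
      ... | yes k≤i | no c≢0  | _ rewrite d-nonzero k≤i c≢0 =
        ∈-⊞-≢0 (-ₛ (a · d (suc i))) c≢0
      -- Here i = k is impossible since `coeff p (suc k)` is nonzero, so `d i` is `a · d (suc i)`
      -- and the two summands are opposite.
      ... | yes k≤i | yes c≡0 | _
        rewrite d-zero (≤∧≢⇒< k≤i λ { refl → opposite-≢0 coeff-suc-k c≡0 }) c≡0 | c≡0 =
        0∈-neg-⊞ (a · d (suc i))
      -- Both i and i + 1 lie in the middle range, so the summands are opposite units and their sum
      -- is all of `𝕊`.
      ... | no k≰i  | _       | yes l≤i
        rewrite neg-·-d (m≤n⇒m≤1+n l≤i) (≰⇒> k≰i) | d-middle l≤i (<⇒≤ (≰⇒> k≰i)) =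
        ∈-⊞-neg _ (reflected-≢0 (suc i))
      -- Now i + 1 ≤ l, so `d i` is 0 and the other summand is the coefficient itself.
      ... | no _    | _       | no l≰i
        rewrite d-low (≰⇒> l≰i) | sym (coeff-up-to-l (≰⇒> l≰i)) =
        ∈-⊞-0 (coeff p (suc i))

mainTheorem11 : ∀ (p : Poly) (n : ℕ) → HasDegree p n → 1 ≤ n →
    ∀ (a : 𝕊) → a ≡ 1ₛ ⊎ a ≡ -1ₛ → IsRoot p a →
    ∃[ l ] ∃[ k ] (IsL p l × IsK p a l k ×
    (let open Quotient p n a l k in
    p ∈ (T- a) ⊡ q
    × coeff p n ≡ d (n ∸ 1)
    × coeff p 0 ≡ -ₛ (a · d 0)
    × (∀ i → 1 ≤ i → i ≤ n ∸ 1 → coeff p i ∈ (-ₛ (a · d i)) ⊞ d (i ∸ 1))))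
mainTheorem11 p (suc m) deg@(cₙ≢0 , _) _ a u root
  with l , isL ← ∃-isL p u deg
  with k , isK ← ∃-isK p u isL root =
  let c₀ = coeff-up-to-l p u isL deg isK z≤n
      c₊ = coeff-∈ p u isL deg isK
  in l , k , isL , isK
   , T-∈-⊡ p a (Quotient.q p (suc m) a l k) c₀ c₊
   -- From k < n the index n - 1 is at least `k`, and the leading coefficient is nonzero.
   , sym (d-nonzero p u isL deg isK (≤-pred (k<n p u isL deg isK)) cₙ≢0)
   , c₀
   , λ { (suc i) _ _ → c₊ i }
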